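{- Let $n$, $k$, $t$ and $s$ be positive integers with $k\geq t+1$ and $n\geq 2(t+1)\left((k-t+1)^{2}+s\right)$. If $\mathcal{F}\subseteq \binom{[n]}{k}$ is an $s$-almost $t$-intersecting family of maximum size (among all $s$-almost $t$-intersecting subfamilies of $\binom{[n]}{k}$), then $\mathcal{F}\cong \left\{F\in\binom{[n]}{k}: [t]\subseteq F\right\}$.
   Context: $[n]=\{1,\dots,n\}$ and $\binom{X}{k}$ denotes the family of all $k$-subsets of a set $X$. A family $\mathcal{F}\subseteq\binom{[n]}{k}$ is called $s$-almost $t$-intersecting if $\left|\{F'\in\mathcal{F}: |F'\cap F|<t\}\right|\leq s$ for every $F\in\mathcal{F}$; it is $t$-intersecting if this holds with $s=0$. For families $\mathcal{F},\mathcal{G}$ of subsets of $[n]$, $\mathcal{F}\cong\mathcal{G}$ means there is a permutation of $[n]$ mapping $\mathcal{F}$ onto $\mathcal{G}$. -}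

module Defs where

open import Data.Nat using (ℕ; _≤_; _<_; _<?_)
open import Data.Fin using (Fin; toℕ)
open import Data.Fin.Subset using (Subset; _∩_; ∣_∣) renaming (_∈_ to _∈ₛ_)
open import Data.Fin.Permutation using (Permutation′; _⟨$⟩ˡ_)
open import Data.Vec using (tabulate; lookup)
open import Data.List using (List; length; filter)
open import Data.List.Relation.Unary.All using (All)
open import Data.List.Relation.Unary.Unique.Propositional using (Unique)
open import Data.List.Membership.Propositional using (_∈_)
open import Data.Product using (Σ; _×_)
open import Relation.Binary.PropositionalEquality using (_≡_)
open import Function.Bundles using (_⇔_)

IsFamily : (n k : ℕ) → List (Subset n) → Set
IsFamily n k 𝓕 = Unique 𝓕 × All (λ F → ∣ F ∣ ≡ k) 𝓕

badCount : {n : ℕ} → ℕ → List (Subset n) → Subset n → ℕ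
badCount t 𝓕 F = length (filter (λ F' → ∣ F' ∩ F ∣ <? t) 𝓕)

AlmostIntersecting : {n : ℕ} → (s t : ℕ) → List (Subset n) → Set
AlmostIntersecting s t 𝓕 = All (λ F → badCount t 𝓕 F ≤ s) 𝓕

IsMaximum : (n k s t : ℕ) → List (Subset n) → Set
IsMaximum n k s t 𝓕 =
  IsFamily n k 𝓕 × AlmostIntersecting s t 𝓕 ×
  ((𝓖 : List (Subset n)) → IsFamily n k 𝓖 → AlmostIntersecting s t 𝓖 → length 𝓖 ≤ length 𝓕)

-- membership in the star { F ∈ ([n] choose k) : [t] ⊆ F }  ([t] = {0,…,t-1} in Fin n)
InStar : (n k t : ℕ) → Subset n → Set
InStar n k t F = ∣ F ∣ ≡ k × ((i : Fin n) → toℕ i < t → i ∈ₛ F)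

-- image of a subset under a permutation σ : σ[G] has i iff σ⁻¹(i) ∈ G
image : {n : ℕ} → Permutation′ n → Subset n → Subset n
image σ G = tabulate (λ i → lookup G (σ ⟨$⟩ˡ i))

IsoToStar : (n k t : ℕ) → List (Subset n) → Set
IsoToStar n k t 𝓕 = Σ (Permutation′ n) (λ σ → (G : Subset n) → (G ∈ 𝓕) ⇔ InStar n k t (image σ G))

{-# OPTIONS --safe #-}
module Submission where

-- Write k = t + d and q = d + 1, and let 𝓕 be a maximum family, so that |𝓕| ≥ C(n-t,d), the size
-- of a star.  Call S a cover if every member of 𝓕 meets S in at least t elements; a cover of size t
-- is a common core, and then 𝓕 is a star by maximality.  Otherwise 𝓕 is too small:
--   * If S is not a cover, say |F₁ ∩ S| < t, pick q elements of F₁ outside S.  All but s members F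
--     satisfy |F ∩ F₁| ≥ t and hence contain one of them, so deg S ≤ s + q · max deg (S ∪ {x}).
--   * If |S| = t + j, then at most (t+1)^j · max { deg T : |T| = t } members meet S in at least
--     t elements: among any t + 1 elements of S, one can be dropped from S.
-- Let S be a cover of least size t + j; if no cover has size < k, let S ∈ 𝓕 and j = d instead, which
-- costs s further members.  Iterating the first bound j times, from the t-sets up to size t + j
-- where C(n-t-j,d-j) bounds the degree, and combining with the second gives |𝓕| < C(n-t,d).

open import Defs
open import Data.Bool using (if_then_else_)
open import Data.Bool.Properties using () renaming (_≟_ to _≟ᵇ_)
open import Data.Fin using (Fin; zero; suc; toℕ; fromℕ<; punchIn; punchOut) renaming (_≟_ to _≟ᶠ_)
open import Data.Fin.Permutation using (Permutation′; _⟨$⟩ʳ_; _⟨$⟩ˡ_; inverseʳ; insert; lift₀; flip)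
import Data.Fin.Permutation as Perm
open import Data.Fin.Properties using (toℕ-fromℕ<; punchIn-punchOut)
open import Data.Fin.Subset renaming (_∈_ to _∈ₛ_; _∉_ to _∉ₛ_; ⊥ to ∅; ⊤ to full)
open import Data.Fin.Subset.Properties
open import Data.List using (List; []; _∷_; _++_; length; filter; map)
open import Data.List.Membership.Propositional using (_∈_; find; lose)
open import Data.List.Membership.Propositional.Properties using (∈-map⁺; ∈-map⁻; ∈-++⁺ˡ; ∈-++⁺ʳ; ∈-++⁻; ∈-∃++; ∈-filter⁻)
open import Data.List.Properties using (length-map; length-++; filter-all; filter-none)
open import Data.List.Relation.Unary.All as All using (All; []; _∷_; all?)
open import Data.List.Relation.Unary.All.Properties using (¬All⇒Any¬; ¬Any⇒All¬)
open import Data.List.Relation.Unary.AllPairs using ([]; _∷_)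
open import Data.List.Relation.Unary.Any as Any using (Any; here; there; any?)
open import Data.List.Relation.Unary.Any.Properties using (¬Any[])
open import Data.List.Relation.Unary.Unique.Propositional using (Unique)
import Data.List.Relation.Unary.Unique.Propositional.Properties as Unique
open import Data.Nat hiding (∣_-_∣)
open import Data.Nat.Combinatorics using (_C_; nC1≡n; nCk+nC[k+1]≡[n+1]C[k+1]; k>n⇒nCk≡0)
open import Data.Nat.Properties
open import Algebra.Properties.CommutativeMonoid.Sum +-0-commutativeMonoid using (sum; sum-permute; sum-cong-≗)
open import Data.Nat.Tactic.RingSolver using (solve-∀)
open import Data.Product using (∃; ∃-syntax; _×_; _,_; proj₁; proj₂)
open import Data.Sum using (_⊎_; inj₁; inj₂; [_,_]′)
open import Data.Unit using (tt)
open import Data.Vec using ([]; _∷_; lookup; here; there)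
open import Data.Vec.Properties using (lookup∘tabulate; lookup⇒[]=; []=⇒lookup; ∷-injectiveʳ; ≡-dec)
open import Function using (_∘_; id; _⇔_; mk⇔; Equivalence)
open import Level using (0ℓ)
open import Relation.Binary.PropositionalEquality
open import Relation.Nullary
open import Relation.Nullary.Decidable using (_×-dec_; decidable-stable)
open import Relation.Unary using (Pred; Decidable)

private
  variable
    n : ℕ
    x : Fin n

-- Arithmetic

-- Pascal's rule splits the binomial on the left, and the induction hypothesis applies to both
-- parts. The identity gives the ratio of consecutive values of `A` below.
nCk-absorption : ∀ n k → suc n * (n C k) ≡ suc k * (suc n C suc k)
nCk-absorption n zero = begin
  suc n * 1      ≡⟨ *-identityʳ (suc n) ⟩
  suc n          ≡⟨ nC1≡n (suc n) ⟨
  suc n C 1      ≡⟨ *-identityˡ _ ⟨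
  1 * (suc n C 1) ∎
  where open ≡-Reasoning
nCk-absorption zero (suc k) = begin
  1 * (0 C suc k)                  ≡⟨⟩
  0                                ≡⟨ *-zeroʳ (suc (suc k)) ⟨
  suc (suc k) * 0                  ≡⟨ cong (suc (suc k) *_) (k>n⇒nCk≡0 {1} {suc (suc k)} (s≤s (s≤s z≤n))) ⟨
  suc (suc k) * (1 C suc (suc k))  ∎
  where open ≡-Reasoning
nCk-absorption (suc n) (suc k) = begin
  (2 + n) * w                                 ≡⟨ cong (λ z → w + (1 + n) * z) (nCk+nC[k+1]≡[n+1]C[k+1] n k) ⟨
  w + (1 + n) * (n C k + n C suc k)           ≡⟨ cong (w +_) (*-distribˡ-+ (1 + n) (n C k) (n C suc k)) ⟩
  w + ((1 + n) * (n C k) + (1 + n) * (n C suc k)) ≡⟨ cong₂ (λ y z → w + (y + z)) (nCk-absorption n k) (nCk-absorption n (suc k)) ⟩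
  w + ((1 + k) * w + (2 + k) * (suc n C suc (suc k))) ≡⟨ +-assoc w _ _ ⟨
  (2 + k) * w + (2 + k) * (suc n C suc (suc k)) ≡⟨ *-distribˡ-+ (2 + k) w _ ⟨
  (2 + k) * (w + (suc n C suc (suc k)))         ≡⟨ cong ((2 + k) *_) (nCk+nC[k+1]≡[n+1]C[k+1] (suc n) (suc k)) ⟩
  (2 + k) * (suc (suc n) C suc (suc k)) ∎
  where
  open ≡-Reasoning
  w = suc n C suc k

^-distribʳ-* : ∀ i m n → (m * n) ^ i ≡ m ^ i * n ^ i
^-distribʳ-* zero    m n = refl
^-distribʳ-* (suc i) m n = begin
  m * n * (m * n) ^ i        ≡⟨ cong (m * n *_) (^-distribʳ-* i m n) ⟩
  m * n * (m ^ i * n ^ i)    ≡⟨ interchange m n (m ^ i) (n ^ i) ⟩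
  m * m ^ i * (n * n ^ i)    ∎
  where
  open ≡-Reasoning
  interchange : ∀ a b c d → a * b * (c * d) ≡ a * c * (b * d)
  interchange = solve-∀

-- The bound that `degree-step` yields when used `i` times in a row, starting from a degree bound
-- `a`.
affineIterate : ℕ → ℕ → ℕ → ℕ → ℕ
affineIterate s q a zero    = a
affineIterate s q a (suc i) = s + q * affineIterate s q a i

-- The extra `s` on the left makes the induction close: since 2s ≤ qs, the quantity b + s grows by
-- at most the factor `q` per iteration.
affineIterate-bound : ∀ s q a i → 2 ≤ q →
  affineIterate s q a (suc i) + s ≤ q ^ i * (2 * s + q * a)
affineIterate-bound s q a zero    _   = ≤-reflexive (lemma s (q * a))
  where
  lemma : ∀ s x → s + x + s ≡ 1 * (2 * s + x)
  lemma = solve-∀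
affineIterate-bound s q a (suc i) 2≤q = begin
  s + q * b + s                  ≡⟨ lemma₁ s (q * b) ⟩
  2 * s + q * b                  ≤⟨ +-monoˡ-≤ (q * b) (*-monoˡ-≤ s 2≤q) ⟩
  q * s + q * b                  ≡⟨ lemma₂ q s b ⟩
  q * (b + s)                    ≤⟨ *-monoʳ-≤ q (affineIterate-bound s q a i 2≤q) ⟩
  q * (q ^ i * (2 * s + q * a))  ≡⟨ *-assoc q (q ^ i) _ ⟨
  q ^ suc i * (2 * s + q * a)    ∎
  where
  open ≤-Reasoning
  b = affineIterate s q a (suc i)
  lemma₁ : ∀ s x → s + x + s ≡ 2 * s + x
  lemma₁ = solve-∀
  lemma₂ : ∀ q s b → q * s + q * b ≡ q * (b + s)
  lemma₂ = solve-∀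

-- With N = n - k, the number of k-sets containing a given set of size k - r is A r.
module Growth (t d s N : ℕ) (N-large : (t + 1) * (2 * d * (d + 1) + 2 * s) ≤ N) where

  c q p : ℕ
  c = t + 1
  q = d + 1
  p = c * q

  A : ℕ → ℕ
  A r = (N + r) C r

  -- By absorption, A (r+1) / A r = (N + r + 1) / (r + 1), and `N` is at least the factor on the
  -- left.
  A-growth : ∀ r → c * (2 * d * q + 2 * s) * A r ≤ suc r * A (suc r)
  A-growth r = begin
    c * (2 * d * q + 2 * s) * A r  ≤⟨ *-monoˡ-≤ (A r) (m≤n⇒m≤1+n (m≤n⇒m≤n+o r N-large)) ⟩
    suc (N + r) * A r              ≡⟨ nCk-absorption (N + r) r ⟩
    suc r * (suc (N + r) C suc r)  ≡⟨ cong (λ z → suc r * (z C suc r)) (+-suc N r) ⟨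
    suc r * A (suc r)              ∎
    where open ≤-Reasoning

  -- The `d` in the term 2dq of `A-growth` pays for the divisor r + 1 ≤ d.
  A-doubling : ∀ {r} → r < d → 2 * p * A r ≤ A (suc r)
  A-doubling {r} r<d = *-cancelˡ-≤ (suc r) (begin
    suc r * (2 * p * A r)          ≤⟨ *-monoˡ-≤ _ r<d ⟩
    d * (2 * p * A r)              ≡⟨ lemma d c q (A r) ⟩
    c * (2 * d * q) * A r          ≤⟨ *-monoˡ-≤ (A r) (*-monoʳ-≤ c (m≤m+n _ (2 * s))) ⟩
    c * (2 * d * q + 2 * s) * A r  ≤⟨ A-growth r ⟩
    suc r * A (suc r)              ∎)
    where
    open ≤-Reasoning
    lemma : ∀ d c q a → d * (2 * (c * q) * a) ≡ c * (2 * d * q) * a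
    lemma = solve-∀

  p^i*A≤A : ∀ i {r} → i + r ≤ d → p ^ i * A r ≤ A (i + r)
  p^i*A≤A zero    {r} _     = ≤-reflexive (*-identityˡ (A r))
  p^i*A≤A (suc i) {r} i+r<d = begin
    p * p ^ i * A r      ≡⟨ *-assoc p (p ^ i) (A r) ⟩
    p * (p ^ i * A r)    ≤⟨ *-mono-≤ (m≤m+n p (p + 0)) (p^i*A≤A i (<⇒≤ i+r<d)) ⟩
    2 * p * A (i + r)    ≤⟨ A-doubling i+r<d ⟩
    A (suc (i + r))      ∎
    where open ≤-Reasoning

  -- Each use of `A-doubling` supplies `p` for the power and 2 for the linear factor, as r + 2 ≤ 2(r
  -- + 1). At r = d - 1 this absorbs a factor `d` in `nontrivial-bound`.
  [1+r]*p^r≤A : ∀ {r} → r ≤ d → suc r * p ^ r ≤ A r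
  [1+r]*p^r≤A {zero}  _   = ≤-refl
  [1+r]*p^r≤A {suc r} r<d = begin
    suc (suc r) * (p * p ^ r)    ≤⟨ *-monoˡ-≤ (p * p ^ r) (s≤s (s≤s (m≤m+n r (r + 0)))) ⟩
    (2 + 2 * r) * (p * p ^ r)    ≡⟨ lemma r p (p ^ r) ⟩
    2 * p * (suc r * p ^ r)      ≤⟨ *-monoʳ-≤ (2 * p) ([1+r]*p^r≤A (<⇒≤ r<d)) ⟩
    2 * p * A r                  ≤⟨ A-doubling r<d ⟩
    A (suc r)                    ∎
    where
    open ≤-Reasoning
    lemma : ∀ r p x → (2 + 2 * r) * (p * x) ≡ 2 * p * (suc r * x)
    lemma = solve-∀

  -- By affineIterate-bound the left side is at most c p^i (2s + q A e).  After multiplication by d,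
  -- its two terms are absorbed by the terms 2cs A(d-1) and 2dp A(d-1) of A-growth, the second with
  -- a factor 2 to spare, which makes the inequality strict.
  nontrivial-bound : ∀ i e → i + suc e ≡ d →
    s + c ^ suc i * affineIterate s q (A e) (suc i) < A d
  nontrivial-bound i e eq with refl ← trans (sym (+-suc i e)) eq = begin-strict
    -- Enlarged to u * s, the free summand `s` becomes the one that `affineIterate-bound` expects.
    s + u * b                          ≤⟨ +-monoˡ-≤ (u * b) (m≤n*m s u {{m^n≢0 c (suc i) {{c≢0}}}}) ⟩
    u * s + u * b                      ≡⟨ *-distribˡ-+ u s b ⟨
    u * (s + b)                        ≡⟨ cong (u *_) (+-comm s b) ⟩
    u * (b + s)                        ≤⟨ *-monoʳ-≤ u (affineIterate-bound s q (A e) i (+-monoˡ-≤ 1 (s≤s (z≤n {i + e})))) ⟩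
    u * (q ^ i * (2 * s + q * A e))    ≡⟨ lemma₁ c (c ^ i) (q ^ i) _ ⟩
    c * (c ^ i * q ^ i * (2 * s + q * A e)) ≡⟨ cong (λ z → c * (z * (2 * s + q * A e))) (^-distribʳ-* i c q) ⟨
    c * (p ^ i * (2 * s + q * A e))    <⟨ *-cancelˡ-< d _ _ scaled ⟩
    A d                                ∎
    where
    open ≤-Reasoning
    D = i + e
    u = c ^ suc i
    b = affineIterate s q (A e) (suc i)
    lemma₁ : ∀ c y z w → c * y * (z * w) ≡ c * (y * z * w)
    lemma₁ = solve-∀
    lemma₂ : ∀ d c y s q a → d * (c * (y * (2 * s + q * a))) ≡ 2 * s * c * (d * y) + d * c * q * (y * a)
    lemma₂ = solve-∀
    lemma₃ : ∀ d c s q a → 2 * s * c * a + d * c * q * a + d * c * q * a ≡ c * (2 * d * q + 2 * s) * a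
    lemma₃ = solve-∀
    c≢0 : NonZero c
    c≢0 = >-nonZero (m≤n+m 1 t)
    q≢0 : NonZero q
    q≢0 = _
    p≢0 : NonZero p
    p≢0 = m*n≢0 c q {{c≢0}} {{q≢0}}
    A>0 : 0 < A D
    A>0 = begin-strict
      0                  <⟨ m^n>0 p {{p≢0}} D ⟩
      p ^ D              ≤⟨ m≤n*m (p ^ D) (suc D) ⟩
      suc D * p ^ D      ≤⟨ [1+r]*p^r≤A (n≤1+n D) ⟩
      A D                ∎
    scaled : d * (c * (p ^ i * (2 * s + q * A e))) < d * A d
    scaled = begin-strict
      d * (c * (p ^ i * (2 * s + q * A e)))
        ≡⟨ lemma₂ d c (p ^ i) s q (A e) ⟩
      2 * s * c * (d * p ^ i) + d * c * q * (p ^ i * A e)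
        ≤⟨ +-mono-≤
             -- Here d = suc D, so d p^i is at most (1 + D) p^D.
             (*-monoʳ-≤ (2 * s * c) (≤-trans (*-monoʳ-≤ d (^-monoʳ-≤ p {{p≢0}} (m≤m+n i e))) ([1+r]*p^r≤A (n≤1+n D))))
             (*-monoʳ-≤ (d * c * q) (p^i*A≤A i (n≤1+n D))) ⟩
      2 * s * c * A D + d * c * q * A D
        <⟨ m<m+n _ (>-nonZero⁻¹ _ {{m*n≢0 (d * c * q) (A D) {{m*n≢0 (d * c) q {{m*n≢0 d c {{_}} {{c≢0}}}} {{q≢0}}}} {{>-nonZero A>0}}}}) ⟩
      2 * s * c * A D + d * c * q * A D + d * c * q * A D
        ≡⟨ lemma₃ d c s q (A D) ⟩
      c * (2 * d * q + 2 * s) * A D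
        ≤⟨ A-growth D ⟩
      d * A d ∎

-- Replacing (d+1)^2 by d(d+1) frees 2(t+1)(d+1), which is more than enough for k = t + d.
N-bound : ∀ n t d s → 2 * (t + 1) * ((d + 1) ^ 2 + s) ≤ n →
  (t + 1) * (2 * d * (d + 1) + 2 * s) + (t + d) ≤ n
N-bound n t d s h = begin
  (t + 1) * (2 * d * (d + 1) + 2 * s) + (t + d)  ≤⟨ m≤m+n _ (2 * t * d + t + d + 2) ⟩
  (t + 1) * (2 * d * (d + 1) + 2 * s) + (t + d) + (2 * t * d + t + d + 2) ≡⟨ lemma t d s ⟩
  2 * (t + 1) * ((d + 1) * ((d + 1) * 1) + s)    ≤⟨ h ⟩
  n ∎
  where
  open ≤-Reasoning
  lemma : ∀ t d s → (t + 1) * (2 * d * (d + 1) + 2 * s) + (t + d) + (2 * t * d + t + d + 2)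
    ≡ 2 * (t + 1) * ((d + 1) * ((d + 1) * 1) + s)
  lemma = solve-∀

-- Finite subsets

∣p∩q∣+∣p─q∣≡∣p∣ : (p q : Subset n) → ∣ p ∩ q ∣ + ∣ p ─ q ∣ ≡ ∣ p ∣
∣p∩q∣+∣p─q∣≡∣p∣ []            []            = refl
∣p∩q∣+∣p─q∣≡∣p∣ (inside  ∷ p) (inside  ∷ q) = cong suc (∣p∩q∣+∣p─q∣≡∣p∣ p q)
∣p∩q∣+∣p─q∣≡∣p∣ (inside  ∷ p) (outside ∷ q) = trans (+-suc ∣ p ∩ q ∣ ∣ p ─ q ∣) (cong suc (∣p∩q∣+∣p─q∣≡∣p∣ p q))
∣p∩q∣+∣p─q∣≡∣p∣ (outside ∷ p) (inside  ∷ q) = ∣p∩q∣+∣p─q∣≡∣p∣ p q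
∣p∩q∣+∣p─q∣≡∣p∣ (outside ∷ p) (outside ∷ q) = ∣p∩q∣+∣p─q∣≡∣p∣ p q

∣p∪⁅x⁆∣≡1+∣p∣ : (p : Subset n) → x ∉ₛ p → ∣ p ∪ ⁅ x ⁆ ∣ ≡ suc ∣ p ∣
∣p∪⁅x⁆∣≡1+∣p∣ {x = zero}  (inside  ∷ p) x∉p = contradiction here x∉p
∣p∪⁅x⁆∣≡1+∣p∣ {x = zero}  (outside ∷ p) x∉p = cong (suc ∘ ∣_∣) (∪-identityʳ p)
∣p∪⁅x⁆∣≡1+∣p∣ {x = suc x} (inside  ∷ p) x∉p = cong suc (∣p∪⁅x⁆∣≡1+∣p∣ p (x∉p ∘ there))
∣p∪⁅x⁆∣≡1+∣p∣ {x = suc x} (outside ∷ p) x∉p = ∣p∪⁅x⁆∣≡1+∣p∣ p (x∉p ∘ there)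

∣p∣≤1+∣p-x∣ : (p : Subset n) (x : Fin n) → ∣ p ∣ ≤ suc ∣ p - x ∣
∣p∣≤1+∣p-x∣ p x = begin
  ∣ p ∣                          ≡⟨ ∣p∩q∣+∣p─q∣≡∣p∣ p ⁅ x ⁆ ⟨
  ∣ p ∩ ⁅ x ⁆ ∣ + ∣ p - x ∣      ≤⟨ +-monoˡ-≤ ∣ p - x ∣ (∣p∩q∣≤∣q∣ p ⁅ x ⁆) ⟩
  ∣ ⁅ x ⁆ ∣ + ∣ p - x ∣          ≡⟨ cong (_+ ∣ p - x ∣) (∣⁅x⁆∣≡1 x) ⟩
  suc ∣ p - x ∣                  ∎
  where open ≤-Reasoning

∣q∣<∣p∣⇒∃∈p∉q : (p q : Subset n) → ∣ q ∣ < ∣ p ∣ → ∃[ x ] x ∈ₛ p × x ∉ₛ q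
∣q∣<∣p∣⇒∃∈p∉q p q ∣q∣<∣p∣ with nonempty? (p ∩ ∁ q)
... | yes (x , x∈) = x , proj₁ (x∈p∩q⁻ p (∁ q) x∈) , x∈∁p⇒x∉p (proj₂ (x∈p∩q⁻ p (∁ q) x∈))
... | no empty = contradiction (p⊆q⇒∣p∣≤∣q∣ p⊆q) (<⇒≱ ∣q∣<∣p∣)
  where
  p⊆q : p ⊆ q
  p⊆q {x} x∈p = decidable-stable (x ∈? q) λ x∉q → empty (x , x∈p∩q⁺ (x∈p , x∉p⇒x∈∁p x∉q))

pigeonhole : (p q r : Subset n) → p ⊆ r → q ⊆ r → ∣ r ∣ < ∣ p ∣ + ∣ q ∣ → ∃[ x ] x ∈ₛ p × x ∈ₛ q
pigeonhole p q r p⊆r q⊆r ∣r∣< with ∣q∣<∣p∣⇒∃∈p∉q q (r ─ p) ∣r─p∣<∣q∣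
  where
  open ≤-Reasoning
  ∣r─p∣<∣q∣ : ∣ r ─ p ∣ < ∣ q ∣
  ∣r─p∣<∣q∣ = +-cancelˡ-< ∣ p ∣ _ _ (begin-strict
    ∣ p ∣ + ∣ r ─ p ∣      ≤⟨ +-monoˡ-≤ ∣ r ─ p ∣ (p⊆q⇒∣p∣≤∣q∣ λ x∈p → x∈p∩q⁺ (p⊆r x∈p , x∈p)) ⟩
    ∣ r ∩ p ∣ + ∣ r ─ p ∣  ≡⟨ ∣p∩q∣+∣p─q∣≡∣p∣ r p ⟩
    ∣ r ∣                  <⟨ ∣r∣< ⟩
    ∣ p ∣ + ∣ q ∣          ∎)
... | x , x∈q , x∉r─p =
  x , decidable-stable (x ∈? p) (λ x∉p → x∉r─p (x∈p∧x∉q⇒x∈p─q (q⊆r x∈q) x∉p)) , x∈q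

∣p∣≤∣q∩p∣⇒p⊆q : (p q : Subset n) → ∣ p ∣ ≤ ∣ q ∩ p ∣ → p ⊆ q
∣p∣≤∣q∩p∣⇒p⊆q p q ∣p∣≤ {x} x∈p = decidable-stable (x ∈? q) λ x∉q →
  <⇒≱ (p⊂q⇒∣p∣<∣q∣ (p∩q⊆q q p , x , x∈p , x∉q ∘ proj₁ ∘ x∈p∩q⁻ q p)) ∣p∣≤

subset-of-size : (p : Subset n) {m : ℕ} → m ≤ ∣ p ∣ → ∃[ q ] q ⊆ p × ∣ q ∣ ≡ m
subset-of-size {n} p             {zero}  _     = ∅ , ⊥⊆ , ∣⊥∣≡0 n
subset-of-size     (inside  ∷ p) {suc m} (s≤s m≤)
  with q , q⊆p , ∣q∣≡m ← subset-of-size p m≤ = inside ∷ q , s⊆s q⊆p , cong suc ∣q∣≡m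
subset-of-size     (outside ∷ p) {suc m} m<
  with q , q⊆p , ∣q∣≡m ← subset-of-size p m< = outside ∷ q , s⊆s q⊆p , ∣q∣≡m

elements : Subset n → List (Fin n)
elements []            = []
elements (inside  ∷ p) = zero ∷ map suc (elements p)
elements (outside ∷ p) = map suc (elements p)

length-elements : (p : Subset n) → length (elements p) ≡ ∣ p ∣
length-elements []            = refl
length-elements (inside  ∷ p) = cong suc (trans (length-map suc (elements p)) (length-elements p))
length-elements (outside ∷ p) = trans (length-map suc (elements p)) (length-elements p)

∈-elements⁺ : {p : Subset n} → x ∈ₛ p → x ∈ elements p
∈-elements⁺                   here       = here refl
∈-elements⁺ {p = inside  ∷ _} (there x∈) = there (∈-map⁺ suc (∈-elements⁺ x∈))
∈-elements⁺ {p = outside ∷ _} (there x∈) = ∈-map⁺ suc (∈-elements⁺ x∈)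

∈-elements⁻ : (p : Subset n) → x ∈ elements p → x ∈ₛ p
∈-elements⁻ (inside ∷ p) (here refl) = here
∈-elements⁻ (inside ∷ p) (there x∈) with _ , y∈ , refl ← ∈-map⁻ suc x∈ = there (∈-elements⁻ p y∈)
∈-elements⁻ (outside ∷ p) x∈ with _ , y∈ , refl ← ∈-map⁻ suc x∈ = there (∈-elements⁻ p y∈)

-- Counting in lists

-- Delete one occurrence of the head of `xs` from `ys`; by uniqueness the tail avoids the head and
-- still lies in what is left.
Unique-⊆⇒length≤ : {A : Set} {xs : List A} → Unique xs → (ys : List A) →
  (∀ {x} → x ∈ xs → x ∈ ys) → length xs ≤ length ys
Unique-⊆⇒length≤ []             ys xs⊆ys = z≤n
Unique-⊆⇒length≤ {xs = x ∷ xs} (x∉xs ∷ xs!) ys xs⊆ys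
  with as , bs , refl ← ∈-∃++ (xs⊆ys (here refl)) = begin
  suc (length xs)                ≤⟨ s≤s (Unique-⊆⇒length≤ xs! (as ++ bs) xs⊆as++bs) ⟩
  suc (length (as ++ bs))        ≡⟨ cong suc (length-++ as) ⟩
  suc (length as + length bs)    ≡⟨ +-suc (length as) (length bs) ⟨
  length as + suc (length bs)    ≡⟨ length-++ as ⟨
  length (as ++ x ∷ bs)          ∎
  where
  open ≤-Reasoning
  xs⊆as++bs : ∀ {y} → y ∈ xs → y ∈ as ++ bs
  xs⊆as++bs y∈xs with ∈-++⁻ as (xs⊆ys (there y∈xs))
  ... | inj₁ y∈as         = ∈-++⁺ˡ y∈as
  ... | inj₂ (here refl)  = contradiction refl (All.lookup x∉xs y∈xs)
  ... | inj₂ (there y∈bs) = ∈-++⁺ʳ as y∈bs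

module _ {A : Set} where

  # : {P : Pred A 0ℓ} → Decidable P → List A → ℕ
  # P? xs = length (filter P? xs)

  #-⊎ : {P Q R : Pred A 0ℓ} (P? : Decidable P) (Q? : Decidable Q) (R? : Decidable R) (xs : List A) →
    (∀ {x} → x ∈ xs → P x → Q x ⊎ R x) → # P? xs ≤ # Q? xs + # R? xs
  #-⊎ P? Q? R? []       _    = z≤n
  #-⊎ P? Q? R? (x ∷ xs) P⇒Q⊎R with #-⊎ P? Q? R? xs (P⇒Q⊎R ∘ there) | P? x | Q? x | R? x
  ... | ih | no _  | no _   | no _   = ih
  ... | ih | no _  | no _   | yes _  = ≤-trans ih (+-monoʳ-≤ (# Q? xs) (n≤1+n _))
  ... | ih | no _  | yes _  | no _   = m≤n⇒m≤1+n ih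
  ... | ih | no _  | yes _  | yes _  = ≤-trans ih (+-mono-≤ (n≤1+n (# Q? xs)) (n≤1+n _))
  ... | ih | yes p | no ¬q  | no ¬r  = contradiction (P⇒Q⊎R (here refl) p) [ ¬q , ¬r ]′
  ... | ih | yes _ | no _   | yes _  = ≤-trans (s≤s ih) (≤-reflexive (sym (+-suc (# Q? xs) _)))
  ... | ih | yes _ | yes _  | no _   = s≤s ih
  ... | ih | yes _ | yes _  | yes _  = s≤s (≤-trans ih (+-monoʳ-≤ (# Q? xs) (n≤1+n _)))

  #-⇒ : {P Q : Pred A 0ℓ} (P? : Decidable P) (Q? : Decidable Q) (xs : List A) →
    (∀ {x} → x ∈ xs → P x → Q x) → # P? xs ≤ # Q? xs
  #-⇒ P? Q? xs P⇒Q = begin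
    # P? xs                        ≤⟨ #-⊎ P? Q? (λ _ → no id) xs (λ x∈ → inj₁ ∘ P⇒Q x∈) ⟩
    # Q? xs + # (λ _ → no id) xs   ≡⟨ cong (# Q? xs +_) (cong length (filter-none (λ _ → no id) {xs} (All.tabulate λ _ → id))) ⟩
    # Q? xs + 0                    ≡⟨ +-identityʳ _ ⟩
    # Q? xs                        ∎
    where open ≤-Reasoning

  #-⋃ : {I : Set} {P : Pred A 0ℓ} {Q : I → Pred A 0ℓ} (P? : Decidable P) (Q? : ∀ i → Decidable (Q i))
    (is : List I) (xs : List A) {B : ℕ} →
    (∀ {x} → x ∈ xs → P x → Any (λ i → Q i x) is) →
    (∀ {i} → i ∈ is → # (Q? i) xs ≤ B) →
    # P? xs ≤ length is * B
  #-⋃ P? Q? []       xs P⇒Q _ =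
    ≤-reflexive (cong length (filter-none P? (All.tabulate λ x∈ p → ¬Any[] (P⇒Q x∈ p))))
  #-⋃ {Q = Q} P? Q? (i ∷ is) xs P⇒Q Q≤B = ≤-trans
    (#-⊎ P? (Q? i) R? xs (λ x∈ → Any.toSum ∘ P⇒Q x∈))
    (+-mono-≤ (Q≤B (here refl)) (#-⋃ R? Q? is xs (λ _ → id) (Q≤B ∘ there)))
    where
    R? : Decidable (λ x → Any (λ i → Q i x) is)
    R? x = any? (λ i → Q? i x) is

  length≤#+# : {Q R : Pred A 0ℓ} (Q? : Decidable Q) (R? : Decidable R) (xs : List A) →
    (∀ {x} → x ∈ xs → Q x ⊎ R x) → length xs ≤ # Q? xs + # R? xs
  length≤#+# Q? R? xs Q⊎R = subst (_≤ # Q? xs + # R? xs)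
    (cong length (filter-all (λ _ → yes tt) (All.tabulate {xs = xs} λ _ → tt)))
    (#-⊎ (λ _ → yes tt) Q? R? xs (λ x∈ _ → Q⊎R x∈))

-- Enumeration of supersets

-- The sets obtained from `S` by adding `e` elements; the recursion follows Pascal's rule. The list
-- serves twice: it bounds degrees from above, and over a t-set it is the star that competes with a
-- maximum family.
supersets : Subset n → ℕ → List (Subset n)
supersets []            zero    = [] ∷ []
supersets []            (suc e) = []
supersets (inside  ∷ S) e       = map (inside ∷_) (supersets S e)
supersets (outside ∷ S) zero    = map (outside ∷_) (supersets S zero)
supersets (outside ∷ S) (suc e) = map (inside ∷_) (supersets S e) ++ map (outside ∷_) (supersets S (suc e))

length-supersets : (S : Subset n) (e : ℕ) → length (supersets S e) ≡ ∣ ∁ S ∣ C e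
length-supersets []            zero    = refl
length-supersets []            (suc e) = refl
length-supersets (inside  ∷ S) e       = trans (length-map _ (supersets S e)) (length-supersets S e)
length-supersets (outside ∷ S) zero    = trans (length-map _ (supersets S zero)) (length-supersets S zero)
length-supersets (outside ∷ S) (suc e) = begin
  length (map (inside ∷_) (supersets S e) ++ map (outside ∷_) (supersets S (suc e)))
    ≡⟨ length-++ (map (inside ∷_) (supersets S e)) ⟩
  length (map (inside ∷_) (supersets S e)) + length (map (outside ∷_) (supersets S (suc e)))
    ≡⟨ cong₂ _+_ (trans (length-map _ (supersets S e)) (length-supersets S e))
                 (trans (length-map _ (supersets S (suc e))) (length-supersets S (suc e))) ⟩
  ∣ ∁ S ∣ C e + ∣ ∁ S ∣ C suc e
    ≡⟨ nCk+nC[k+1]≡[n+1]C[k+1] ∣ ∁ S ∣ e ⟩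
  suc ∣ ∁ S ∣ C suc e ∎
  where open ≡-Reasoning

supersets-Unique : (S : Subset n) (e : ℕ) → Unique (supersets S e)
supersets-Unique []            zero    = [] ∷ []
supersets-Unique []            (suc e) = []
supersets-Unique (inside  ∷ S) e       = Unique.map⁺ ∷-injectiveʳ (supersets-Unique S e)
supersets-Unique (outside ∷ S) zero    = Unique.map⁺ ∷-injectiveʳ (supersets-Unique S zero)
supersets-Unique (outside ∷ S) (suc e) = Unique.++⁺
  (Unique.map⁺ ∷-injectiveʳ (supersets-Unique S e))
  (Unique.map⁺ ∷-injectiveʳ (supersets-Unique S (suc e)))
  disjoint
  where
  disjoint : ∀ {F} → ¬ (F ∈ map (inside ∷_) (supersets S e) × F ∈ map (outside ∷_) (supersets S (suc e)))
  disjoint (F∈₁ , F∈₂) with _ , _ , refl ← ∈-map⁻ _ F∈₁ | _ , _ , () ← ∈-map⁻ _ F∈₂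

∈-supersets⁺ : (S : Subset n) (e : ℕ) (F : Subset n) → S ⊆ F → ∣ F ∣ ≡ ∣ S ∣ + e → F ∈ supersets S e
∈-supersets⁺ []            zero    []            _   _   = here refl
∈-supersets⁺ (inside  ∷ S) e       (inside  ∷ F) S⊆F ∣F∣ =
  ∈-map⁺ _ (∈-supersets⁺ S e F (drop-∷-⊆ S⊆F) (cong pred ∣F∣))
∈-supersets⁺ (inside  ∷ S) e       (outside ∷ F) S⊆F ∣F∣ with () ← S⊆F here
∈-supersets⁺ (outside ∷ S) zero    (inside  ∷ F) S⊆F ∣F∣ =
  contradiction (p⊆q⇒∣p∣≤∣q∣ (drop-∷-⊆ S⊆F)) (<⇒≱ (≤-reflexive (trans ∣F∣ (+-identityʳ ∣ S ∣))))
∈-supersets⁺ (outside ∷ S) zero    (outside ∷ F) S⊆F ∣F∣ =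
  ∈-map⁺ _ (∈-supersets⁺ S zero F (drop-∷-⊆ S⊆F) ∣F∣)
∈-supersets⁺ (outside ∷ S) (suc e) (inside  ∷ F) S⊆F ∣F∣ =
  ∈-++⁺ˡ (∈-map⁺ _ (∈-supersets⁺ S e F (drop-∷-⊆ S⊆F) (cong pred (trans ∣F∣ (+-suc ∣ S ∣ e)))))
∈-supersets⁺ (outside ∷ S) (suc e) (outside ∷ F) S⊆F ∣F∣ =
  ∈-++⁺ʳ (map (inside ∷_) (supersets S e)) (∈-map⁺ _ (∈-supersets⁺ S (suc e) F (drop-∷-⊆ S⊆F) ∣F∣))

∈-supersets⁻ : (S : Subset n) (e : ℕ) {F : Subset n} → F ∈ supersets S e → S ⊆ F × ∣ F ∣ ≡ ∣ S ∣ + e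
∈-supersets⁻ []            zero    (here refl) = id , refl
∈-supersets⁻ (inside  ∷ S) e       F∈ with G , G∈ , refl ← ∈-map⁻ _ F∈
  with S⊆G , ∣G∣ ← ∈-supersets⁻ S e G∈ = s⊆s S⊆G , cong suc ∣G∣
∈-supersets⁻ (outside ∷ S) zero    F∈ with G , G∈ , refl ← ∈-map⁻ _ F∈
  with S⊆G , ∣G∣ ← ∈-supersets⁻ S zero G∈ = s⊆s S⊆G , ∣G∣
∈-supersets⁻ (outside ∷ S) (suc e) F∈ with ∈-++⁻ (map (inside ∷_) (supersets S e)) F∈
... | inj₁ F∈₁ with G , G∈ , refl ← ∈-map⁻ _ F∈₁
  with S⊆G , ∣G∣ ← ∈-supersets⁻ S e G∈ = out⊆ S⊆G , trans (cong suc ∣G∣) (sym (+-suc ∣ S ∣ e))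
... | inj₂ F∈₂ with G , G∈ , refl ← ∈-map⁻ _ F∈₂
  with S⊆G , ∣G∣ ← ∈-supersets⁻ S (suc e) G∈ = s⊆s S⊆G , ∣G∣

-- Permutations

-- With size written as a sum of indicators, its invariance under permutations is a reindexing of
-- the sum.
indicator : Subset n → Fin n → ℕ
indicator p i = if lookup p i then 1 else 0

∣p∣≡sum : (p : Subset n) → ∣ p ∣ ≡ sum (indicator p)
∣p∣≡sum []            = refl
∣p∣≡sum (inside  ∷ p) = cong suc (∣p∣≡sum p)
∣p∣≡sum (outside ∷ p) = ∣p∣≡sum p

∣image∣ : (σ : Permutation′ n) (p : Subset n) → ∣ image σ p ∣ ≡ ∣ p ∣
∣image∣ σ p = begin
  ∣ image σ p ∣                        ≡⟨ ∣p∣≡sum (image σ p) ⟩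
  sum (indicator (image σ p))          ≡⟨ sum-cong-≗ (λ i → cong (λ b → if b then 1 else 0) (lookup∘tabulate (λ j → lookup p (σ ⟨$⟩ˡ j)) i)) ⟩
  sum (λ i → indicator p (σ ⟨$⟩ˡ i))   ≡⟨ sum-permute (indicator p) (flip σ) ⟨
  sum (indicator p)                    ≡⟨ ∣p∣≡sum p ⟨
  ∣ p ∣                                ∎
  where open ≡-Reasoning

∈-image : (σ : Permutation′ n) (p : Subset n) (i : Fin n) → i ∈ₛ image σ p ⇔ (σ ⟨$⟩ˡ i) ∈ₛ p
∈-image σ p i = mk⇔
  (λ i∈ → lookup⇒[]= _ p (trans (sym (lookup∘tabulate _ i)) ([]=⇒lookup i∈)))
  (λ i∈ → lookup⇒[]= i _ (trans (lookup∘tabulate _ i) ([]=⇒lookup i∈)))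

-- `punchIn i` fixes the indices below `i` and moves all others past `i`.
toℕ-punchIn-< : ∀ (i : Fin (suc n)) (j : Fin n) → toℕ (punchIn i j) < toℕ i ⇔ toℕ j < toℕ i
toℕ-punchIn-< zero    j       = mk⇔ (λ ()) (λ ())
toℕ-punchIn-< (suc i) zero    = mk⇔ (λ _ → s≤s z≤n) (λ _ → s≤s z≤n)
toℕ-punchIn-< (suc i) (suc j) = mk⇔
  (s≤s ∘ Equivalence.to (toℕ-punchIn-< i j) ∘ s≤s⁻¹)
  (s≤s ∘ Equivalence.from (toℕ-punchIn-< i j) ∘ s≤s⁻¹)


-- Recursion on `T`: a head inside `T` is the image of position zero, and a head outside `T` is the
-- image of position |T|, the first one past the initial segment.
initial-segment⇔ : ∀ {n} (T : Subset n) → ∃ λ (ρ : Permutation′ n) → ∀ i → toℕ i < ∣ T ∣ ⇔ (ρ ⟨$⟩ʳ i) ∈ₛ T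
initial-segment⇔ [] = Perm.id , λ ()
initial-segment⇔ (inside ∷ T) with ρ , ρ-spec ← initial-segment⇔ T = lift₀ ρ , spec
  where
  spec : ∀ i → toℕ i < suc ∣ T ∣ ⇔ (lift₀ ρ ⟨$⟩ʳ i) ∈ₛ inside ∷ T
  spec zero    = mk⇔ (λ _ → here) (λ _ → s≤s z≤n)
  spec (suc i) = mk⇔
    (there ∘ Equivalence.to (ρ-spec i) ∘ s≤s⁻¹)
    (s≤s ∘ Equivalence.from (ρ-spec i) ∘ drop-there)
initial-segment⇔ {suc n} (outside ∷ T) with ρ , ρ-spec ← initial-segment⇔ T = insert m zero ρ , spec
  where
  m : Fin (suc n)
  m = fromℕ< (s≤s (∣p∣≤n T))
  m≡∣T∣ : toℕ m ≡ ∣ T ∣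
  m≡∣T∣ = toℕ-fromℕ< (s≤s (∣p∣≤n T))
  spec : ∀ i → toℕ i < ∣ T ∣ ⇔ (insert m zero ρ ⟨$⟩ʳ i) ∈ₛ outside ∷ T
  spec i with m ≟ᶠ i
  ... | yes refl = mk⇔ (λ m<∣T∣ → contradiction m≡∣T∣ (<⇒≢ m<∣T∣)) (λ ())
  ... | no  m≢i  = mk⇔
    (λ i<∣T∣ → there (Equivalence.to (ρ-spec j) (subst (toℕ j <_) m≡∣T∣
      (Equivalence.to (toℕ-punchIn-< m j) (subst₂ (λ a b → toℕ a < b) (sym (punchIn-punchOut m≢i)) (sym m≡∣T∣) i<∣T∣)))))
    (λ ρj∈ → subst₂ (λ a b → toℕ a < b) (punchIn-punchOut m≢i) m≡∣T∣
      (Equivalence.from (toℕ-punchIn-< m j) (subst (toℕ j <_) (sym m≡∣T∣) (Equivalence.from (ρ-spec j) (drop-there ρj∈)))))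
    where
    j = punchOut m≢i

-- Almost intersecting families

degree : List (Subset n) → Subset n → ℕ
degree 𝓕 S = # (S ⊆?_) 𝓕

coverCount : ℕ → List (Subset n) → Subset n → ℕ
coverCount t 𝓕 S = # (λ F → t ≤? ∣ F ∩ S ∣) 𝓕

Cover : ℕ → List (Subset n) → Subset n → Set
Cover t 𝓕 S = All (λ F → t ≤ ∣ F ∩ S ∣) 𝓕

Cover? : ∀ t (𝓕 : List (Subset n)) → Decidable (Cover t 𝓕)
Cover? t 𝓕 S = all? (λ F → t ≤? ∣ F ∩ S ∣) 𝓕

degree≤ : ∀ {k} {𝓕 : List (Subset n)} → IsFamily n k 𝓕 → (S : Subset n) (e : ℕ) → k ≡ ∣ S ∣ + e →
  degree 𝓕 S ≤ (n ∸ ∣ S ∣) C e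
degree≤ {n} {k} {𝓕} (𝓕! , sizes) S e k≡ = begin
  degree 𝓕 S              ≤⟨ Unique-⊆⇒length≤ (Unique.filter⁺ (S ⊆?_) 𝓕!) (supersets S e) superset ⟩
  length (supersets S e)  ≡⟨ length-supersets S e ⟩
  ∣ ∁ S ∣ C e             ≡⟨ cong (_C e) (∣∁p∣≡n∸∣p∣ S) ⟩
  (n ∸ ∣ S ∣) C e         ∎
  where
  open ≤-Reasoning
  superset : ∀ {F} → F ∈ filter (S ⊆?_) 𝓕 → F ∈ supersets S e
  superset {F} F∈ with F∈𝓕 , S⊆F ← ∈-filter⁻ (S ⊆?_) {xs = 𝓕} F∈ =
    ∈-supersets⁺ S e F S⊆F (trans (All.lookup sizes F∈𝓕) k≡)

-- Any two members share the t elements of `T`, so every bad count is zero.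
common-core⇒AlmostIntersecting : ∀ s {t} {𝓖 : List (Subset n)} {T : Subset n} → ∣ T ∣ ≡ t →
  (∀ {G} → G ∈ 𝓖 → T ⊆ G) → AlmostIntersecting s t 𝓖
common-core⇒AlmostIntersecting s {t} {T = T} ∣T∣≡t T⊆ = All.tabulate λ {F} F∈ →
  ≤-trans (≤-reflexive (cong length (filter-none (λ F' → ∣ F' ∩ F ∣ <? t)
    (All.tabulate λ {F'} F'∈ → ≤⇒≯ (≤-trans (≤-reflexive (sym ∣T∣≡t))
      (p⊆q⇒∣p∣≤∣q∣ λ x∈T → x∈p∩q⁺ (T⊆ F'∈ x∈T , T⊆ F∈ x∈T)))))))
  z≤n

-- Elements of `S` are dropped one at a time, with t + 1 choices each, until a t-set remains; a
-- member meeting it in t elements contains it.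
coverCount≤ : ∀ t (𝓕 : List (Subset n)) {B} →
  (∀ T → ∣ T ∣ ≡ t → degree 𝓕 T ≤ B) →
  ∀ j S → ∣ S ∣ ≡ j + t → coverCount t 𝓕 S ≤ suc t ^ j * B
coverCount≤ t 𝓕 {B} degree≤B zero S ∣S∣≡t = begin
  coverCount t 𝓕 S  ≤⟨ #-⇒ (λ F → t ≤? ∣ F ∩ S ∣) (S ⊆?_) 𝓕 (λ {F} _ t≤ → ∣p∣≤∣q∩p∣⇒p⊆q S F (≤-trans (≤-reflexive ∣S∣≡t) t≤)) ⟩
  degree 𝓕 S        ≤⟨ degree≤B S ∣S∣≡t ⟩
  B                 ≡⟨ *-identityˡ B ⟨
  1 * B             ∎
  where open ≤-Reasoning
coverCount≤ {n} t 𝓕 {B} degree≤B (suc j) S ∣S∣≡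
  with Y , Y⊆S , ∣Y∣≡1+t ← subset-of-size S {suc t} (≤-trans (s≤s (m≤n+m t j)) (≤-reflexive (sym ∣S∣≡))) = begin
  coverCount t 𝓕 S                         ≤⟨ #-⋃ (λ F → t ≤? ∣ F ∩ S ∣) (λ y F → t ≤? ∣ F ∩ (S - y) ∣) (elements Y) 𝓕
                                                (λ {F} _ → still-covered F)
                                                (λ {y} y∈ → coverCount≤ t 𝓕 degree≤B j (S - y) (∣S-y∣ (Y⊆S (∈-elements⁻ Y y∈)))) ⟩
  length (elements Y) * (suc t ^ j * B)    ≡⟨ cong (_* (suc t ^ j * B)) (trans (length-elements Y) ∣Y∣≡1+t) ⟩
  suc t * (suc t ^ j * B)                  ≡⟨ *-assoc (suc t) (suc t ^ j) B ⟨
  suc t ^ suc j * B                        ∎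
  where
  open ≤-Reasoning
  ∣S-y∣ : ∀ {y} → y ∈ₛ S → ∣ S - y ∣ ≡ j + t
  ∣S-y∣ {y} y∈S = suc-injective (trans (≤-antisym (x∈p⇒∣p-x∣<∣p∣ y∈S) (∣p∣≤1+∣p-x∣ S y)) ∣S∣≡)

  still-covered : ∀ F → t ≤ ∣ F ∩ S ∣ → Any (λ y → t ≤ ∣ F ∩ (S - y) ∣) (elements Y)
  still-covered F t≤ with suc t ≤? ∣ F ∩ S ∣
  -- There is an element to spare, so any y in `Y` may be dropped.
  ... | yes t< with y , y∈Y , _ ← ∣q∣<∣p∣⇒∃∈p∉q Y ∅ (subst₂ _<_ (sym (∣⊥∣≡0 n)) (sym ∣Y∣≡1+t) z<s) =
    lose (∈-elements⁺ y∈Y) (begin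
      t                    ≤⟨ s≤s⁻¹ (≤-trans t< (∣p∣≤1+∣p-x∣ (F ∩ S) y)) ⟩
      ∣ (F ∩ S) - y ∣      ≤⟨ p⊆q⇒∣p∣≤∣q∣ (λ {x} → remove-inside x) ⟩
      ∣ F ∩ (S - y) ∣      ∎)
    where
    remove-inside : ∀ x → x ∈ₛ (F ∩ S) - y → x ∈ₛ F ∩ (S - y)
    remove-inside x x∈ with x∈F , x∈S ← x∈p∩q⁻ F S (p─q⊆p (F ∩ S) ⁅ y ⁆ x∈) =
      x∈p∩q⁺ (x∈F , x∈p∧x≢y⇒x∈p-y x∈S λ where
        -- `y` is not in (F ∩ S) - y: removing it again would shrink the set, but set difference is
        -- idempotent.
        refl → <⇒≢ (x∈p⇒∣p-x∣<∣p∣ x∈) (cong ∣_∣ (p─q─q≡p─q (F ∩ S) ⁅ y ⁆)))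
  ... | no t≮ with y , y∈Y , y∉F∩S ← ∣q∣<∣p∣⇒∃∈p∉q Y (F ∩ S) (subst (∣ F ∩ S ∣ <_) (sym ∣Y∣≡1+t) (≰⇒> t≮)) =
    lose (∈-elements⁺ y∈Y) (≤-trans t≤ (p⊆q⇒∣p∣≤∣q∣ {q = F ∩ (S - y)} λ x∈ →
      x∈p∩q⁺ (proj₁ (x∈p∩q⁻ F S x∈) , x∈p∧x≢y⇒x∈p-y (proj₂ (x∈p∩q⁻ F S x∈)) λ where refl → y∉F∩S x∈)))

-- At most t - 1 of the t + d elements of `F` lie in `S`; this is where q = d + 1 comes from.
remainder-size : ∀ {t d} (S F : Subset n) → ∣ F ∣ ≡ t + d → ∣ F ∩ S ∣ < t → d + 1 ≤ ∣ F ─ S ∣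
remainder-size {t = t} {d} S F ∣F∣≡ ∣F∩S∣<t = +-cancelˡ-≤ t _ _ (begin
  t + (d + 1)                ≡⟨ +-assoc t d 1 ⟨
  t + d + 1                  ≡⟨ cong (_+ 1) ∣F∣≡ ⟨
  ∣ F ∣ + 1                  ≡⟨ +-comm ∣ F ∣ 1 ⟩
  suc ∣ F ∣                  ≡⟨ cong suc (∣p∩q∣+∣p─q∣≡∣p∣ F S) ⟨
  suc ∣ F ∩ S ∣ + ∣ F ─ S ∣  ≤⟨ +-monoˡ-≤ _ ∣F∩S∣<t ⟩
  t + ∣ F ─ S ∣              ∎)
  where open ≤-Reasoning

-- Brings the binomial of `degree≤` into the form `A e` with N = n - k.
n∸m≡n∸k+e : ∀ {n k m e} → k ≡ m + e → k ≤ n → n ∸ m ≡ n ∸ k + e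
n∸m≡n∸k+e {n} {m = m} {e} refl k≤n = begin
  n ∸ m                      ≡⟨ cong (_∸ m) (m∸n+n≡m k≤n) ⟨
  n ∸ (m + e) + (m + e) ∸ m  ≡⟨ cong (λ z → n ∸ (m + e) + z ∸ m) (+-comm m e) ⟩
  n ∸ (m + e) + (e + m) ∸ m  ≡⟨ cong (_∸ m) (+-assoc (n ∸ (m + e)) e m) ⟨
  n ∸ (m + e) + e + m ∸ m    ≡⟨ m+n∸n≡m (n ∸ (m + e) + e) m ⟩
  n ∸ (m + e) + e            ∎
  where open ≡-Reasoning

-- Bounds for families without a common core

module _ {t d s : ℕ} {𝓕 : List (Subset n)}
  (isFamily : IsFamily n (t + d) 𝓕) (almost : AlmostIntersecting s t 𝓕) where

  private
    size : ∀ {F} → F ∈ 𝓕 → ∣ F ∣ ≡ t + d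
    size = All.lookup (proj₂ isFamily)

  degree-step : ∀ {S B} → ¬ Cover t 𝓕 S →
    (∀ x → x ∉ₛ S → degree 𝓕 (S ∪ ⁅ x ⁆) ≤ B) →
    degree 𝓕 S ≤ s + (d + 1) * B
  degree-step {S} {B} ¬cover degree≤B
    with F₁ , F₁∈ , ∣F₁∩S∣≱t ← find (¬All⇒Any¬ (λ F → t ≤? ∣ F ∩ S ∣) 𝓕 ¬cover)
    with X , X⊆F₁─S , ∣X∣≡ ← subset-of-size (F₁ ─ S) {d + 1} (remainder-size S F₁ (size F₁∈) (≰⇒> ∣F₁∩S∣≱t))
    = begin
    degree 𝓕 S                            ≤⟨ #-⊎ (S ⊆?_) (λ F → ∣ F ∩ F₁ ∣ <? t) extends? 𝓕 (λ {F} → meets F) ⟩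
    badCount t 𝓕 F₁ + # extends? 𝓕        ≤⟨ +-mono-≤ (All.lookup almost F₁∈)
                                               (#-⋃ extends? (λ x F → (S ∪ ⁅ x ⁆) ⊆? F) (elements X) 𝓕 (λ _ → id)
                                                 (λ {x} x∈ → degree≤B x (x∉S (X⊆F₁─S (∈-elements⁻ X x∈))))) ⟩
    s + length (elements X) * B           ≡⟨ cong (λ z → s + z * B) (trans (length-elements X) ∣X∣≡) ⟩
    s + (d + 1) * B                       ∎
    where
    open ≤-Reasoning
    extends? : Decidable (λ F → Any (λ x → (S ∪ ⁅ x ⁆) ⊆ F) (elements X))
    extends? F = any? (λ x → (S ∪ ⁅ x ⁆) ⊆? F) (elements X)

    x∉S : ∀ {x} → x ∈ₛ F₁ ─ S → x ∉ₛ S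
    x∉S {x} x∈ x∈S = <⇒≢ (p∩q≢∅⇒∣p─q∣<∣p∣ (F₁ ─ S) S (x , x∈p∩q⁺ (x∈ , x∈S))) (cong ∣_∣ (p─q─q≡p─q F₁ S))

    meets : ∀ F → F ∈ 𝓕 → S ⊆ F → ∣ F ∩ F₁ ∣ < t ⊎ Any (λ x → (S ∪ ⁅ x ⁆) ⊆ F) (elements X)
    meets F _ S⊆F with ∣ F ∩ F₁ ∣ <? t
    ... | yes bad = inj₁ bad
    ... | no ¬bad
      -- F ∩ F₁ and `X` are subsets of F₁ with at least t + d + 1 elements in total, one more than
      -- F₁ has.
      with x , x∈F∩F₁ , x∈X ← pigeonhole (F ∩ F₁) X F₁ (p∩q⊆q F F₁) (p─q⊆p F₁ S ∘ X⊆F₁─S) (begin-strict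
        ∣ F₁ ∣                  ≡⟨ size F₁∈ ⟩
        t + d                   <⟨ +-monoʳ-< t (m<m+n d z<s) ⟩
        t + (d + 1)             ≤⟨ +-mono-≤ (≮⇒≥ ¬bad) (≤-reflexive (sym ∣X∣≡)) ⟩
        ∣ F ∩ F₁ ∣ + ∣ X ∣      ∎)
      = inj₂ (lose (∈-elements⁺ x∈X) λ y∈ → [S∪x]⊆F (x∈p∪q⁻ S ⁅ x ⁆ y∈))
      where
      [S∪x]⊆F : ∀ {y} → y ∈ₛ S ⊎ y ∈ₛ ⁅ x ⁆ → y ∈ₛ F
      [S∪x]⊆F (inj₁ y∈S) = S⊆F y∈S
      [S∪x]⊆F (inj₂ y∈x) = subst (_∈ₛ F) (sym (x∈⁅y⁆⇒x≡y x y∈x)) (proj₁ (x∈p∩q⁻ F F₁ x∈F∩F₁))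

  NoCover : ℕ → Set
  NoCover m = ∀ S → ∣ S ∣ ≡ m → ¬ Cover t 𝓕 S

  -- Each use of `degree-step` enlarges the set by one element, so covers must be excluded at every
  -- size from `l` to m - 1; at size `m` the bound `a` takes over.
  degree-iterate : ∀ {a m} →
    (∀ S → ∣ S ∣ ≡ m → degree 𝓕 S ≤ a) →
    ∀ i {l} → l + i ≡ m → (∀ {e} → l ≤ e → e < m → NoCover e) →
    ∀ S → ∣ S ∣ ≡ l → degree 𝓕 S ≤ affineIterate s (d + 1) a i
  degree-iterate base zero l+0≡m _ S ∣S∣≡l = base S (trans ∣S∣≡l (trans (sym (+-identityʳ _)) l+0≡m))
  degree-iterate base (suc i) {l} refl noCover S ∣S∣≡l = degree-step
    (noCover ≤-refl (m<m+n l z<s) S ∣S∣≡l)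
    (λ x x∉S → degree-iterate base i (sym (+-suc l i)) (λ l<e → noCover (<⇒≤ l<e))
      (S ∪ ⁅ x ⁆) (trans (∣p∪⁅x⁆∣≡1+∣p∣ S x∉S) (cong suc ∣S∣≡l)))

  module _ (N-large : (t + 1) * (2 * d * (d + 1) + 2 * s) ≤ n ∸ (t + d)) (k≤n : t + d ≤ n) where

    open Growth t d s (n ∸ (t + d)) N-large

    -- The hypothesis on `S` tolerates `s` uncovered members, so that both a cover and a member of 𝓕
    -- qualify. Degrees of t-sets are traced up to size t + suc i = k - e, where `A e` bounds them.
    near-cover⇒small : ∀ i e → i + suc e ≡ d →
      (∀ {m} → t ≤ m → m < t + suc i → NoCover m) →
      ∀ S → ∣ S ∣ ≡ suc i + t → length 𝓕 ≤ s + coverCount t 𝓕 S →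
      length 𝓕 < A d
    near-cover⇒small i e i+1+e≡d noCover S ∣S∣≡ near = begin-strict
      length 𝓕                              ≤⟨ near ⟩
      s + coverCount t 𝓕 S                  ≤⟨ +-monoʳ-≤ s (coverCount≤ t 𝓕 core-degree (suc i) S ∣S∣≡) ⟩
      s + suc t ^ suc i * b                 ≡⟨ cong (λ z → s + z ^ suc i * b) (+-comm 1 t) ⟩
      s + (t + 1) ^ suc i * b               <⟨ nontrivial-bound i e i+1+e≡d ⟩
      A d                                   ∎
      where
      open ≤-Reasoning
      b = affineIterate s (d + 1) (A e) (suc i)
      k≡ : t + d ≡ t + suc i + e
      k≡ = trans (cong (t +_) (trans (sym i+1+e≡d) (+-suc i e))) (sym (+-assoc t (suc i) e))
      core-degree : ∀ T → ∣ T ∣ ≡ t → degree 𝓕 T ≤ b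
      core-degree = degree-iterate
        (λ R ∣R∣≡ → let k≡∣R∣+e = trans k≡ (cong (_+ e) (sym ∣R∣≡)) in
          ≤-trans (degree≤ isFamily R e k≡∣R∣+e) (≤-reflexive (cong (_C e) (n∸m≡n∸k+e k≡∣R∣+e k≤n))))
        (suc i) refl noCover

    -- Searches for a cover at the sizes t + suc i in increasing order, with `r` the distance to k.
    -- At r = 0 the size is k itself, and F₀ takes the place of the cover: at most `s` members meet
    -- it in fewer than t elements.
    no-core⇒small : ∀ {F₀} → F₀ ∈ 𝓕 → ∀ r i → i + suc r ≡ d →
      (∀ {m} → t ≤ m → m < t + suc i → NoCover m) → length 𝓕 < A d
    no-core⇒small {F₀} F₀∈ zero i i+1≡d noCover = near-cover⇒small i zero i+1≡d noCover F₀
      (trans (size F₀∈) (trans (+-comm t d) (cong (_+ t) (trans (sym i+1≡d) (+-comm i 1)))))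
      (≤-trans (length≤#+# (λ F → ∣ F ∩ F₀ ∣ <? t) (λ F → t ≤? ∣ F ∩ F₀ ∣) 𝓕 (λ {F} _ → <-≤-connex ∣ F ∩ F₀ ∣ t))
               (+-monoˡ-≤ _ (All.lookup almost F₀∈)))
    no-core⇒small F₀∈ (suc r) i i+2+r≡d noCover
      with anySubset? (λ S → (∣ S ∣ ≟ t + suc i) ×-dec Cover? t 𝓕 S)
    ... | yes (S , ∣S∣≡ , cover) = near-cover⇒small i (suc r) i+2+r≡d noCover S
      (trans ∣S∣≡ (+-comm t (suc i)))
      (≤-trans (≤-reflexive (cong length (sym (filter-all (λ F → t ≤? ∣ F ∩ S ∣) cover)))) (m≤n+m _ s))
    ... | no ¬cover = no-core⇒small F₀∈ r (suc i) (trans (sym (+-suc i (suc r))) i+2+r≡d) noCover′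
      where
      noCover′ : ∀ {m} → t ≤ m → m < t + suc (suc i) → NoCover m
      noCover′ {m} t≤m m< with m ≟ t + suc i
      ... | yes refl = λ S ∣S∣≡ cover → ¬cover (S , ∣S∣≡ , cover)
      ... | no m≢    = noCover t≤m (≤∧≢⇒< (s≤s⁻¹ (subst (m <_) (+-suc t (suc i)) m<)) m≢)

    -- If no t-set is a cover, the search for a larger one makes 𝓕 smaller than a star, as (n - t) C
    -- d is `A d`.
    core : 1 ≤ d → (n ∸ t) C d ≤ length 𝓕 → ∃[ T ] ∣ T ∣ ≡ t × (∀ {F} → F ∈ 𝓕 → T ⊆ F)
    core (s≤s {n = r} _) large with anySubset? (λ T → (∣ T ∣ ≟ t) ×-dec Cover? t 𝓕 T)
    ... | yes (T , ∣T∣≡t , cover) = T , ∣T∣≡t , λ {F} F∈ →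
      ∣p∣≤∣q∩p∣⇒p⊆q T F (≤-trans (≤-reflexive ∣T∣≡t) (All.lookup cover F∈))
    ... | no ¬cover = contradiction (subst (λ m → m C d ≤ length 𝓕) (n∸m≡n∸k+e {m = t} refl k≤n) large) (<⇒≱ (small _ refl))
      where
      noCover : ∀ {m} → t ≤ m → m < t + 1 → NoCover m
      noCover {m} t≤m m<t+1 S ∣S∣≡m cover =
        ¬cover (S , trans ∣S∣≡m (≤-antisym (s≤s⁻¹ (subst (m <_) (+-comm t 1) m<t+1)) t≤m) , cover)
      -- The copy 𝓖 permits a case split on 𝓕. An empty family offers no F₀, but `nontrivial-bound`
      -- shows that `A d` is positive.
      small : ∀ 𝓖 → 𝓖 ≡ 𝓕 → length 𝓕 < A d
      small []      refl = ≤-<-trans z≤n (nontrivial-bound 0 r refl)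
      small (_ ∷ _) refl = no-core⇒small (here refl) r 0 refl noCover

-- Maximum families and stars

star-size : ∀ {t d} s {𝓕 : List (Subset n)} → t + d ≤ n → IsMaximum n (t + d) s t 𝓕 →
  (n ∸ t) C d ≤ length 𝓕
star-size {n} {t} {d} s {𝓕} k≤n (_ , _ , maximal)
  with T , _ , ∣T∣≡t ← subset-of-size full {t} (≤-trans (m+n≤o⇒m≤o t k≤n) (≤-reflexive (sym (∣⊤∣≡n n)))) = begin
  (n ∸ t) C d              ≡⟨ cong (λ m → (n ∸ m) C d) ∣T∣≡t ⟨
  (n ∸ ∣ T ∣) C d          ≡⟨ cong (_C d) (∣∁p∣≡n∸∣p∣ T) ⟨
  ∣ ∁ T ∣ C d              ≡⟨ length-supersets T d ⟨
  length (supersets T d)   ≤⟨ maximal (supersets T d)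
                                (supersets-Unique T d , All.tabulate λ G∈ → trans (proj₂ (∈-supersets⁻ T d G∈)) (cong (_+ d) ∣T∣≡t))
                                (common-core⇒AlmostIntersecting s ∣T∣≡t (λ G∈ → proj₁ (∈-supersets⁻ T d G∈))) ⟩
  length 𝓕                 ∎
  where open ≤-Reasoning

-- A k-set containing `T` but missing from 𝓕 could be added: `T` would remain a common core,
-- contradicting maximality.
maximum⇒star : ∀ {k s t} {𝓕 : List (Subset n)} (T : Subset n) → ∣ T ∣ ≡ t → IsMaximum n k s t 𝓕 →
  (∀ {F} → F ∈ 𝓕 → T ⊆ F) → ∀ G → G ∈ 𝓕 ⇔ (∣ G ∣ ≡ k × T ⊆ G)
maximum⇒star {n} {k} {s} {𝓕 = 𝓕} T ∣T∣≡t ((𝓕! , sizes) , _ , maximal) T⊆ G = mk⇔ to from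
  where
  to : G ∈ 𝓕 → ∣ G ∣ ≡ k × T ⊆ G
  to G∈ = All.lookup sizes G∈ , T⊆ G∈

  from : ∣ G ∣ ≡ k × T ⊆ G → G ∈ 𝓕
  from (∣G∣≡k , T⊆G) = decidable-stable (any? (≡-dec _≟ᵇ_ G) 𝓕) λ G∉𝓕 →
    1+n≰n (maximal (G ∷ 𝓕) (¬Any⇒All¬ 𝓕 G∉𝓕 ∷ 𝓕! , ∣G∣≡k ∷ sizes)
      (common-core⇒AlmostIntersecting s ∣T∣≡t λ { (here refl) → T⊆G ; (there F∈) → T⊆ F∈ }))

-- The permutation ρ carries [t] onto `T`. Since `image` looks elements up along the inverse,
-- `flip ρ` is the witness: i lies in the image of G exactly when ρ i lies in G.
star⇒IsoToStar : ∀ {k t} {𝓕 : List (Subset n)} (T : Subset n) → ∣ T ∣ ≡ t →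
  (∀ G → G ∈ 𝓕 ⇔ (∣ G ∣ ≡ k × T ⊆ G)) → IsoToStar n k t 𝓕
star⇒IsoToStar T ∣T∣≡t star with ρ , ρ-spec ← initial-segment⇔ T = flip ρ , λ G → mk⇔
  (λ G∈ → let ∣G∣≡k , T⊆G = to (star G) G∈ in
    trans (∣image∣ (flip ρ) G) ∣G∣≡k ,
    λ i i<t → from (∈-image (flip ρ) G i) (T⊆G (to (ρ-spec i) (subst (toℕ i <_) (sym ∣T∣≡t) i<t))))
  (λ (∣σG∣≡k , [t]⊆σG) → from (star G)
    ( trans (sym (∣image∣ (flip ρ) G)) ∣σG∣≡k
    , λ {x} x∈T → subst (_∈ₛ G) (inverseʳ ρ)
        (to (∈-image (flip ρ) G (ρ ⟨$⟩ˡ x))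
          ([t]⊆σG _ (subst (_ <_) ∣T∣≡t (from (ρ-spec _) (subst (_∈ₛ T) (sym (inverseʳ ρ)) x∈T)))))))
  where open Equivalence using (to; from)

theorem1p1 : (n k t s : ℕ) → 1 ≤ n → 1 ≤ k → 1 ≤ t → 1 ≤ s →
    t + 1 ≤ k →
    2 * (t + 1) * ((k ∸ t + 1) ^ 2 + s) ≤ n →
    (𝓕 : List (Subset n)) → IsMaximum n k s t 𝓕 → IsoToStar n k t 𝓕
theorem1p1 n k t s _ _ _ _ t+1≤k n-large 𝓕 maximum
  with d , refl ← m≤n⇒∃[o]m+o≡n (m+n≤o⇒m≤o t t+1≤k)
  with n-large′ ← N-bound n t d s (subst (λ z → 2 * (t + 1) * ((z + 1) ^ 2 + s) ≤ n) (m+n∸m≡n t d) n-large)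
  -- The inequality from `N-bound` has k as a summand; it yields both k ≤ n and the lower bound on n
  -- - k.
  with k≤n ← m+n≤o⇒n≤o ((t + 1) * (2 * d * (d + 1) + 2 * s)) n-large′
  with N-large ← m+n≤o⇒m≤o∸n _ n-large′
  with isFamily , almost , _ ← maximum
  with T , ∣T∣≡t , T⊆ ← core isFamily almost N-large k≤n (+-cancelˡ-≤ t 1 d t+1≤k)
    (star-size s k≤n maximum)
  = star⇒IsoToStar T ∣T∣≡t (maximum⇒star T ∣T∣≡t maximum T⊆)
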